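{- Let $d$ be a positive integer and let $G$ be a triangle-free $4$-sunspot-free graph of minimum degree at least $4d-1$ that is both liberal and flapless. Let $H$ be a hole of length at least $6$ in $G$. Then there is a full $d$-safe $H$-flare in $G$.
   Context: Graphs are finite and simple. A $4$-sunspot in $G$ is a $7$-tuple $(x_1,x_2,x_3,x_4;y_1,y_2,y_3)$ of pairwise distinct vertices such that the edges of $G$ among them are exactly $x_1x_2,x_2x_3,x_3x_4,x_4x_1,x_1y_1,x_2y_2,x_3y_3$; $G$ is $4$-sunspot-free if none exists. A hole is an induced cycle on at least four vertices, its length being its number of edges. For a hole $H$, an $H$-flap is a hole of length $4$ sharing at least one edge with $H$. $G$ is liberal if for all distinct non-adjacent vertices $x,y$, both $N(x)\setminus N(y)$ and $N(y)\setminus N(x)$ are nonempty; $G$ is flapless if for every hole $H$ of length at least $6$ there is no $H$-flap. Sets $X,Y$ are anticomplete if they are disjoint and there is no edge between them. For a hole $H$, an $H$-flare is a map $\Phi$ from $V(H)$ to subsets of $V(G)\setminus V(H)$ with $\Phi(h)\subseteq N_G(h)\setminus V(H)$ and $|\Phi(h)|\leq 1$ for all $h$; write $\Phi[h]=\Phi(h)\cup\{h\}$. $\Phi$ is full if $|\Phi(h)|=1$ for every $h\in V(H)$, and $d$-safe if for all $h,h'\in V(H)$ at distance at most $d$ in $H$, the sets $\Phi(h)$ and $\Phi[h']$ are anticomplete.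
   Formalization: In the definition of d-safe, the anticompleteness of Φ(h) and Φ[h'] is required only for distinct h, h' at distance at most d; taken literally with h = h' (distance 0), no full flare could be d-safe. -}

module Defs where

open import Data.Nat using (ℕ; zero; suc; _+_; _*_; _∸_; _≤_; _<_; _%_)
open import Data.Fin using (Fin; toℕ)
open import Data.Bool using (Bool; true; false; _∨_)
open import Data.List using (List; length; filterᵇ; allFin)
open import Data.Product using (Σ; ∃; _×_; _,_)
open import Data.Sum using (_⊎_)
open import Data.Maybe using (Maybe; just; nothing)
open import Relation.Nullary using (¬_)
open import Data.Empty using (⊥)
open import Relation.Binary.PropositionalEquality using (_≡_; _≢_)
open import Function.Definitions using (Injective)

record Graph : Set where
  field
    n     : ℕ
    adj   : Fin n → Fin n → Bool
    sym   : ∀ u v → adj u v ≡ adj v u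
    irrefl : ∀ v → adj v v ≡ false

module _ (G : Graph) where
  open Graph G

  V : Set
  V = Fin n

  Adj : V → V → Set
  Adj u v = adj u v ≡ true

  degree : V → ℕ
  degree v = length (filterᵇ (adj v) (allFin n))

  MinDegreeAtLeast : ℕ → Set
  MinDegreeAtLeast m = ∀ v → m ≤ degree v

  TriangleFree : Set
  TriangleFree = ∀ a b c → Adj a b → Adj b c → Adj a c → ⊥

CycAdj : (k : ℕ) → Fin k → Fin k → Set
CycAdj k i j = (toℕ j ≡ (suc (toℕ i)) % suc (k ∸ 1)) ⊎ (toℕ i ≡ (suc (toℕ j)) % suc (k ∸ 1))

absDiff : ℕ → ℕ → ℕ
absDiff a b = (a ∸ b) + (b ∸ a)

cycDist : (k : ℕ) → Fin k → Fin k → ℕ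
cycDist k i j = Data.Nat._⊓_ (absDiff (toℕ i) (toℕ j)) (k ∸ absDiff (toℕ i) (toℕ j))
  where import Data.Nat

module _ (G : Graph) where
  open Graph G

  IsInducedCycle : (k : ℕ) → (Fin k → V G) → Set
  IsInducedCycle k h = Injective _≡_ _≡_ h
                     × (∀ i j → (Adj G (h i) (h j) → CycAdj k i j)
                              × (CycAdj k i j → Adj G (h i) (h j)))

  record Hole : Set where
    field
      len     : ℕ
      len≥4   : 4 ≤ len
      vx      : Fin len → V G
      induced : IsInducedCycle len vx

  InHole : Hole → V G → Set
  InHole H v = ∃ λ i → Hole.vx H i ≡ v

  ShareEdge : Hole → Hole → Set
  ShareEdge H C = ∃ λ i → ∃ λ j → ∃ λ a → ∃ λ b →
      CycAdj (Hole.len H) i j × CycAdj (Hole.len C) a b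
    × Hole.vx H i ≡ Hole.vx C a × Hole.vx H j ≡ Hole.vx C b

  Flap : Hole → Set
  Flap H = Σ Hole λ C → (Hole.len C ≡ 4) × ShareEdge H C

  Flapless : Set
  Flapless = ∀ (H : Hole) → 6 ≤ Hole.len H → ¬ Flap H

  NbrDiffNonempty : V G → V G → Set
  NbrDiffNonempty x y = ∃ λ z → Adj G x z × ¬ Adj G y z

  Liberal : Set
  Liberal = ∀ x y → x ≢ y → ¬ Adj G x y → NbrDiffNonempty x y × NbrDiffNonempty y x

  -- 4-sunspot: positions 0,1,2,3 = x1..x4 ; 4,5,6 = y1,y2,y3
  sunEdgeℕ : ℕ → ℕ → Bool
  sunEdgeℕ 0 1 = true
  sunEdgeℕ 1 2 = true
  sunEdgeℕ 2 3 = true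
  sunEdgeℕ 3 0 = true
  sunEdgeℕ 0 4 = true
  sunEdgeℕ 1 5 = true
  sunEdgeℕ 2 6 = true
  sunEdgeℕ _ _ = false

  SunEdge : Fin 7 → Fin 7 → Set
  SunEdge a b = (sunEdgeℕ (toℕ a) (toℕ b) ∨ sunEdgeℕ (toℕ b) (toℕ a)) ≡ true

  Is4Sunspot : (Fin 7 → V G) → Set
  Is4Sunspot s = Injective _≡_ _≡_ s
               × (∀ a b → (Adj G (s a) (s b) → SunEdge a b) × (SunEdge a b → Adj G (s a) (s b)))

  SunspotFree4 : Set
  SunspotFree4 = ∀ s → ¬ Is4Sunspot s

  Anticomplete : (V G → Set) → (V G → Set) → Set
  Anticomplete X Y = ∀ x y → X x → Y y → (x ≢ y) × ¬ Adj G x y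

  -- An H-flare: Φ(h) ⊆ N(h) \ V(H), |Φ(h)| ≤ 1 (a Maybe vertex)
  record Flare (H : Hole) : Set where
    field
      Φ       : Fin (Hole.len H) → Maybe (V G)
      inNbr   : ∀ i v → Φ i ≡ just v → Adj G (Hole.vx H i) v
      outside : ∀ i v → Φ i ≡ just v → ¬ InHole H v

  module _ {H : Hole} (F : Flare H) where
    open Flare F

    InΦ : Fin (Hole.len H) → V G → Set
    InΦ i v = Φ i ≡ just v

    InΦ[] : Fin (Hole.len H) → V G → Set
    InΦ[] i v = InΦ i v ⊎ v ≡ Hole.vx H i

    Full : Set
    Full = ∀ i → ∃ λ v → Φ i ≡ just v

    Safe : ℕ → Set
    Safe d = ∀ i j → i ≢ j → cycDist (Hole.len H) i j ≤ d → Anticomplete (InΦ i) (InΦ[] j)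

{-# OPTIONS --safe #-}

-- No vertex h of H lies on a 4-cycle: otherwise private neighbours of the other three vertices of
-- the cycle, together with a neighbour of h in H, yield a 4-sunspot, a triangle or an H-flap.
-- Hence every vertex other than h has at most one common neighbour with h. Petals can therefore
-- be chosen greedily: at h it suffices to avoid the neighbours of the hole vertices at distance
-- 2, …, d, of their petals, and of the two hole vertices at distance 2. These are at most
-- 4(d − 1) + 2 < 4d − 1 vertices, each excluding at most one neighbour of h.
module Submission where

open import Defs
open import Data.Bool using (Bool; true; false; _∨_)
open import Data.Bool.Properties using (¬-not; not-¬; ∨-comm; T?; T-≡)
import Data.Bool.Properties as Bool
open import Data.Empty using (⊥; ⊥-elim)
open import Data.Fin using (Fin; zero; suc; toℕ)
open import Data.Fin.Patterns
open import Data.Fin.Properties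
  using (toℕ-injective; toℕ<n; toℕ-fromℕ<; suc-injective; pigeonhole; all?; <-cmp; _≟_)
import Data.Fin as Fin
open import Data.List using (List; []; _∷_; _++_; length; lookup; map; filterᵇ; allFin; tabulate; applyUpTo)
open import Data.List.Membership.Propositional using (_∈_)
open import Data.List.Membership.Propositional.Properties
  using (∈-lookup; ∈-applyUpTo⁺; ∈-++⁺ˡ; ∈-++⁺ʳ; ∈-map⁺; ∈-filter⁻)
open import Data.List.Properties using (length-++; length-map; length-applyUpTo)
import Data.List.Relation.Unary.All as All
open All using (All; []; _∷_)
open import Data.List.Relation.Unary.All.Properties using (¬Any⇒All¬)
import Data.List.Relation.Unary.All.Properties as All
open import Data.List.Relation.Unary.AllPairs using (AllPairs; []; _∷_)
import Data.List.Relation.Unary.Any as Any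
open Any using (Any; here; there; any?)
open import Data.List.Relation.Unary.Any.Properties using (lookup-index; lookup-result)
open import Data.List.Relation.Unary.Unique.Propositional using (Unique)
open import Data.List.Relation.Unary.Unique.Propositional.Properties using (allFin⁺; filter⁺)
open import Data.Maybe using (just)
open import Data.Nat using (ℕ; zero; suc; _+_; _*_; _∸_; _≤_; _<_; _%_; _⊓_; z≤n; s≤s; s≤s⁻¹)
open import Data.Nat.DivMod
  using (_mod_; m%n%n≡m%n; [m+n]%n≡m%n; m<n⇒m%n≡m; %-distribˡ-+; m≤n⇒[n∸m]%m≡n%m)
open import Data.Nat.Properties
  hiding (_≟_; <-cmp; suc-injective)
import Data.Nat.Properties as ℕ
open import Data.Nat.Tactic.RingSolver using (solve-∀)
open import Data.Product using (Σ; ∃; _×_; _,_; proj₁; proj₂)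
open import Data.Sum using (_⊎_; inj₁; inj₂; [_,_]′)
import Data.Sum as Sum
open import Data.Vec.Functional using () renaming (_∷_ to _∷ᶠ_)
open import Function using (_∘_; id; Equivalence)
open import Function.Definitions using (Injective)
open import Relation.Binary using (tri<; tri≈; tri>)
open import Relation.Binary.PropositionalEquality
  using (_≡_; _≢_; refl; sym; trans; cong; cong₂; subst; ≢-sym; module ≡-Reasoning)
open import Relation.Nullary using (¬_; Dec; yes; no; contradiction)
open import Relation.Nullary.Decidable using (from-yes; ¬?; _×-dec_; _⊎-dec_; _→-dec_; does)

-- Pigeonhole and greedy selection over finite index sets.

unrelated-element : ∀ {A B : Set} {R : B → A → Set} → (∀ k v → Dec (R k v)) →
  (ks : List B) (vs : List A) → Unique vs →
  (∀ {k v w} → v ∈ vs → w ∈ vs → R k v → R k w → v ≡ w) →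
  length ks < length vs →
  ∃ λ v → v ∈ vs × (∀ {k} → k ∈ ks → ¬ R k v)
unrelated-element {R = R} R? ks vs uniq functional short
  with any? (λ v → All.all? (λ k → ¬? (R? k v)) ks) vs
... | yes found = Any.lookup found , ∈-lookup (Any.index found) , All.lookup (lookup-result found)
-- Sending each element of `vs` to a key related to it, two elements share a key, since there are
-- fewer keys. `functional` makes them equal, against uniqueness.
... | no none =
  let i , j , i<j , same = pigeonhole short (λ i → Any.index (blocked i))
      related = λ i → lookup-index (blocked i)
  in contradiction
       (functional (∈-lookup i) (∈-lookup j) (related i)
         (subst (λ k → R (lookup ks k) (lookup vs j)) (sym same) (related j)))
       (lookup-≢ uniq i<j)
  where
  blocked : ∀ i → Any (λ k → R k (lookup vs i)) ks
  blocked i with any? (λ k → R? k (lookup vs i)) ks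
  ... | yes b = b
  ... | no ¬b = contradiction (¬Any⇒All¬ ks ¬b) (All.lookup (¬Any⇒All¬ vs none) (∈-lookup i))

  lookup-≢ : ∀ {vs} → Unique vs → ∀ {i j} → i Fin.< j → lookup vs i ≢ lookup vs j
  lookup-≢ (x ∷ _)  {zero}  {suc j} _   = All.lookup x (∈-lookup j)
  lookup-≢ (_ ∷ xs) {suc i} {suc j} i<j = lookup-≢ xs (s≤s⁻¹ i<j)

-- Values are chosen from the last index down. `step` must cope with any `φ`, but owes `Q` only
-- where `φ` already satisfies `P`, so indices still unfilled may hold default values.
greedy-choice : ∀ {k} {A : Set} (P : Fin k → A → Set) (Q : Fin k → Fin k → A → A → Set) →
  (Fin k → A) →
  (∀ i (φ : Fin k → A) → ∃ λ v → P i v × (∀ j → i ≢ j → P j (φ j) → Q i j v (φ j))) →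
  ∃ λ (φ : Fin k → A) → (∀ i → P i (φ i)) × (∀ i j → i Fin.< j → Q i j (φ i) (φ j))
greedy-choice {zero}  P Q default step = default , (λ ()) , λ ()
greedy-choice {suc k} P Q default step
  with greedy-choice (P ∘ suc) (λ i j → Q (suc i) (suc j)) (default ∘ suc)
         (λ i φ → let v , p , q = step (suc i) (default zero ∷ᶠ φ)
                  in v , p , λ j i≢j → q (suc j) (i≢j ∘ suc-injective))
... | φ , φ-P , φ-Q with step zero (default zero ∷ᶠ φ)
... | v , p , q = (v ∷ᶠ φ) , all-P , all-Q
  where
  all-P : ∀ i → P i ((v ∷ᶠ φ) i)
  all-P zero    = p
  all-P (suc i) = φ-P i

  all-Q : ∀ i j → i Fin.< j → Q i j ((v ∷ᶠ φ) i) ((v ∷ᶠ φ) j)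
  all-Q zero    (suc j) _   = q (suc j) (λ ()) (φ-P j)
  all-Q (suc i) (suc j) i<j = φ-Q i j (s≤s⁻¹ i<j)

upper-triangle : ∀ {k} {A : Set} {R : A → A → Set} (f : Fin k → A) →
  AllPairs R (tabulate f) → ∀ {i j} → i Fin.< j → R (f i) (f j)
upper-triangle f (r ∷ _)  {zero}  {suc j} _   = All.tabulate⁻ r j
upper-triangle f (_ ∷ rs) {suc i} {suc j} i<j = upper-triangle (f ∘ suc) rs (s≤s⁻¹ i<j)

injective-from-pairs : ∀ {k} {A : Set} (s : Fin k → A) →
  AllPairs _≢_ (tabulate s) → Injective _≡_ _≡_ s
injective-from-pairs s distinct {i} {j} eq with <-cmp i j
... | tri< i<j _ _ = contradiction eq (upper-triangle s distinct i<j)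
... | tri≈ _ i≡j _ = i≡j
... | tri> _ _ j<i = contradiction (sym eq) (upper-triangle s distinct j<i)

-- Rotations of a cycle

rot : ∀ {k} → ℕ → Fin k → Fin k
rot {suc k} s i = (toℕ i + s) mod suc k

toℕ-rot : ∀ {k} s (i : Fin (suc k)) → toℕ (rot s i) ≡ (toℕ i + s) % suc k
toℕ-rot s i = toℕ-fromℕ< _

rot-rot : ∀ {k} s t (i : Fin k) → rot t (rot s i) ≡ rot (s + t) i
rot-rot {suc k} s t i = toℕ-injective (begin
  toℕ (rot t (rot s i))             ≡⟨ toℕ-rot t (rot s i) ⟩
  (toℕ (rot s i) + t) % n           ≡⟨ cong (λ x → (x + t) % n) (toℕ-rot s i) ⟩
  ((x + s) % n + t) % n             ≡⟨ %-distribˡ-+ ((x + s) % n) t n ⟩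
  ((x + s) % n % n + t % n) % n     ≡⟨ cong (λ y → (y + t % n) % n) (m%n%n≡m%n (x + s) n) ⟩
  ((x + s) % n + t % n) % n         ≡⟨ %-distribˡ-+ (x + s) t n ⟨
  (x + s + t) % n                   ≡⟨ cong (_% n) (+-assoc x s t) ⟩
  (x + (s + t)) % n                 ≡⟨ toℕ-rot (s + t) i ⟨
  toℕ (rot (s + t) i)               ∎)
  where
  open ≡-Reasoning
  n = suc k
  x = toℕ i

rot-period : ∀ {k} (i : Fin k) → rot k i ≡ i
rot-period {suc k} i = toℕ-injective
  (trans (toℕ-rot (suc k) i) (trans ([m+n]%n≡m%n (toℕ i) (suc k)) (m<n⇒m%n≡m (toℕ<n i))))

rot-back : ∀ {k s} → s ≤ k → (i : Fin k) → rot (k ∸ s) (rot s i) ≡ i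
rot-back {k} {s} s≤k i =
  trans (rot-rot s (k ∸ s) i) (trans (cong (λ t → rot t i) (m+[n∸m]≡n s≤k)) (rot-period i))

-- Adding `s` either moves strictly past `i` or wraps once and lands strictly before it.
rot-≢ : ∀ {k s} → 0 < s → s < k → (i : Fin k) → rot s i ≢ i
rot-≢ {suc k} {s} 0<s s<n i eq with toℕ i + s ℕ.<? suc k
... | yes small = <⇒≢ (m<m+n (toℕ i) 0<s)
  (trans (cong toℕ (sym eq)) (trans (toℕ-rot s i) (m<n⇒m%n≡m small)))
... | no large = <⇒≢ ∸-lt (trans (sym value) (cong toℕ eq))
  where
  n≤i+s = ≮⇒≥ large
  ∸-lt : toℕ i + s ∸ suc k < toℕ i
  ∸-lt = +-cancelʳ-< (suc k) _ _ (subst (_< toℕ i + suc k) (sym (m∸n+n≡m n≤i+s)) (+-monoʳ-< (toℕ i) s<n))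
  value : toℕ (rot s i) ≡ toℕ i + s ∸ suc k
  value = trans (toℕ-rot s i) (trans (sym (m≤n⇒[n∸m]%m≡n%m n≤i+s))
            (m<n⇒m%n≡m (<-trans ∸-lt (toℕ<n i))))

CycAdj-rot : ∀ {k} (i : Fin k) → CycAdj k i (rot 1 i)
CycAdj-rot {suc k} i = inj₁ (trans (toℕ-rot 1 i) (cong (_% suc k) (+-comm (toℕ i) 1)))

CycAdj-sym : ∀ {k} {i j : Fin k} → CycAdj k i j → CycAdj k j i
CycAdj-sym = Sum.swap

CycAdj-rot⁻ : ∀ {k} (i : Fin k) → 1 ≤ k → CycAdj k i (rot (k ∸ 1) i)
CycAdj-rot⁻ {k} i 1≤k = CycAdj-sym (subst (CycAdj k (rot (k ∸ 1) i))
  (trans (rot-rot (k ∸ 1) 1 i) (trans (cong (λ t → rot t i) (m∸n+n≡m 1≤k)) (rot-period i)))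
  (CycAdj-rot (rot (k ∸ 1) i)))

CycAdj⇒rot : ∀ {k} {i j : Fin k} → CycAdj k i j → j ≡ rot 1 i ⊎ i ≡ rot 1 j
CycAdj⇒rot {suc k} = Sum.map next next
  where
  next : ∀ {i j : Fin (suc k)} → toℕ j ≡ suc (toℕ i) % suc k → j ≡ rot 1 i
  next {i} eq = toℕ-injective
    (trans eq (trans (cong (_% suc k) (+-comm 1 (toℕ i))) (sym (toℕ-rot 1 i))))

absDiff-comm : ∀ a b → absDiff a b ≡ absDiff b a
absDiff-comm a b = +-comm (a ∸ b) (b ∸ a)

cycDist-comm : ∀ k (i j : Fin k) → cycDist k i j ≡ cycDist k j i
cycDist-comm k i j = cong (λ a → a ⊓ (k ∸ a)) (absDiff-comm (toℕ i) (toℕ j))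

rot-absDiff : ∀ {k} (i j : Fin k) → i Fin.< j → j ≡ rot (absDiff (toℕ i) (toℕ j)) i
rot-absDiff {suc k} i j i<j = toℕ-injective (sym (begin
  toℕ (rot (absDiff (toℕ i) (toℕ j)) i)           ≡⟨ toℕ-rot _ i ⟩
  (toℕ i + (toℕ i ∸ toℕ j + (toℕ j ∸ toℕ i))) % suc k
    ≡⟨ cong (λ t → (toℕ i + (t + (toℕ j ∸ toℕ i))) % suc k) (m≤n⇒m∸n≡0 (<⇒≤ i<j)) ⟩
  (toℕ i + (toℕ j ∸ toℕ i)) % suc k               ≡⟨ cong (_% suc k) (m+[n∸m]≡n (<⇒≤ i<j)) ⟩
  toℕ j % suc k                                   ≡⟨ m<n⇒m%n≡m (toℕ<n j) ⟩
  toℕ j                                           ∎))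
  where open ≡-Reasoning

absDiff-bounds : ∀ {k} (i j : Fin k) → i Fin.< j →
  let a = absDiff (toℕ i) (toℕ j) in 0 < a × a < k
absDiff-bounds i j i<j rewrite m≤n⇒m∸n≡0 (<⇒≤ i<j) =
  m<n⇒0<n∸m i<j , ≤-<-trans (m∸n≤m (toℕ j) (toℕ i)) (toℕ<n j)

-- Rotation only goes forward, so `s` steps back are written as `k ∸ s` steps forward.
ShiftBy : ∀ {k} → ℕ → Fin k → Fin k → Set
ShiftBy {k} d i j = ∃ λ s → 0 < s × s ≤ d × (j ≡ rot s i ⊎ j ≡ rot (k ∸ s) i)

-- `cycDist` is the smaller of the two arcs between `i` and `j`; the arc attaining it supplies the
-- shift. Both directions are returned so that `shift` can treat either order of the indices.
ordered-shift : ∀ {k d} (i j : Fin k) → i Fin.< j → cycDist k i j ≤ d → ShiftBy d i j × ShiftBy d j i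
ordered-shift {k} {d} i j i<j near
  with absDiff (toℕ i) (toℕ j) | rot-absDiff i j i<j | absDiff-bounds i j i<j
... | a | j≡ | 0<a , a<k =
  [ (λ eq → short (subst (_≤ d) eq near)) , (λ eq → long (subst (_≤ d) eq near)) ]′ (⊓-sel a (k ∸ a))
  where
  i≡ : i ≡ rot (k ∸ a) j
  i≡ = sym (trans (cong (rot (k ∸ a)) j≡) (rot-back (<⇒≤ a<k) i))
  a≡ : a ≡ k ∸ (k ∸ a)
  a≡ = sym (m∸[m∸n]≡n (<⇒≤ a<k))
  short : a ≤ d → ShiftBy d i j × ShiftBy d j i
  short a≤d = (a , 0<a , a≤d , inj₁ j≡) , (a , 0<a , a≤d , inj₂ i≡)
  long : k ∸ a ≤ d → ShiftBy d i j × ShiftBy d j i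
  long b≤d = (k ∸ a , m<n⇒0<n∸m a<k , b≤d , inj₂ (trans j≡ (cong (λ t → rot t i) a≡)))
           , (k ∸ a , m<n⇒0<n∸m a<k , b≤d , inj₁ i≡)

shift : ∀ {k d} (i j : Fin k) → i ≢ j → cycDist k i j ≤ d → ShiftBy d i j
shift {k} {d} i j i≢j near with <-cmp i j
... | tri< i<j _ _ = proj₁ (ordered-shift i j i<j near)
... | tri≈ _ i≡j _ = contradiction i≡j i≢j
... | tri> _ _ j<i = proj₂ (ordered-shift j i j<i (subst (_≤ d) (cycDist-comm k i j) near))

-- Offsets run from 2 to `d + 1` on each side; hole neighbours, at offset 1, are handled by other
-- means. On a short hole entries may repeat, but only the length of the list is counted.
nearby : ∀ {k} → ℕ → Fin k → List (Fin k)
nearby {k} d i = applyUpTo (λ s → rot (2 + s) i) d ++ applyUpTo (λ s → rot (k ∸ (2 + s)) i) d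

length-nearby : ∀ {k} d (i : Fin k) → length (nearby d i) ≡ d + d
length-nearby d i = trans (length-++ (applyUpTo _ d))
  (cong₂ _+_ (length-applyUpTo _ d) (length-applyUpTo _ d))

∈-nearby : ∀ {k d} (i j : Fin k) → 1 ≤ k → i ≢ j → cycDist k i j ≤ suc d →
  CycAdj k i j ⊎ j ∈ nearby d i
∈-nearby {k} {d} i j 1≤k i≢j near with shift i j i≢j near
... | 1 , _ , _ , inj₁ refl = inj₁ (CycAdj-rot i)
... | 1 , _ , _ , inj₂ refl = inj₁ (CycAdj-rot⁻ i 1≤k)
... | suc (suc s) , _ , s≤s s<d , inj₁ refl =
  inj₂ (∈-++⁺ˡ (∈-applyUpTo⁺ (λ s → rot (2 + s) i) s<d))
... | suc (suc s) , _ , s≤s s<d , inj₂ refl =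
  inj₂ (∈-++⁺ʳ _ (∈-applyUpTo⁺ (λ s → rot (k ∸ (2 + s)) i) s<d))

-- Adjacency, 4-cycles and sunspots in triangle-free graphs.

module _ (G : Graph) where
  open Graph G using (n; adj; irrefl) renaming (sym to adj-sym)

  Adj-sym : ∀ {u v} → Adj G u v → Adj G v u
  Adj-sym {u} {v} = trans (adj-sym v u)

  Adj? : ∀ u v → Dec (Adj G u v)
  Adj? u v = adj u v Bool.≟ true

  Adj⇒≢ : ∀ {u v} → Adj G u v → u ≢ v
  Adj⇒≢ {u} uv refl = not-¬ uv (irrefl u)

  distinguished : ∀ {u v w} → Adj G u w → ¬ Adj G v w → u ≢ v
  distinguished uw ¬vw refl = ¬vw uw

  neighbours : V G → List (V G)
  neighbours v = filterᵇ (adj v) (allFin n)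

  neighbours-unique : ∀ v → Unique (neighbours v)
  neighbours-unique v = filter⁺ (T? ∘ adj v) (allFin⁺ n)

  ∈-neighbours⁻ : ∀ {v w} → w ∈ neighbours v → Adj G v w
  ∈-neighbours⁻ {v} w∈ = Equivalence.to T-≡ (proj₂ (∈-filter⁻ (T? ∘ adj v) {xs = allFin n} w∈))

  -- Both sides are symmetric and vanish on the diagonal, so the rows above the diagonal suffice.
  adjacency-pattern : ∀ {k} (E : Fin k → Fin k → Bool) →
    (∀ a b → E a b ≡ E b a) → (∀ a → E a a ≡ false) → (s : Fin k → V G) →
    AllPairs (λ a b → adj (s a) (s b) ≡ E a b) (allFin k) → ∀ a b → adj (s a) (s b) ≡ E a b
  adjacency-pattern E E-sym E-irrefl s pairs a b with <-cmp a b
  ... | tri< a<b _ _  = upper-triangle id pairs a<b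
  ... | tri≈ _ refl _ = trans (irrefl (s a)) (sym (E-irrefl a))
  ... | tri> _ _ b<a  = trans (adj-sym (s a) (s b)) (trans (upper-triangle id pairs b<a) (E-sym b a))

  module _ (triangle-free : TriangleFree G) where

    no-triangle : ∀ {a b c} → Adj G a b → Adj G b c → adj a c ≡ false
    no-triangle ab bc = ¬-not (triangle-free _ _ _ ab bc)

    -- A chord would close a triangle, so every 4-cycle is a hole. The two equations expose the edge
    -- `pq`, to be identified later with an edge of `H`.
    four-cycle : ∀ p q r s → Adj G p q → Adj G q r → Adj G r s → Adj G s p →
      p ≢ r → q ≢ s →
      Σ (Hole G) λ C → Σ (Hole.len C ≡ 4) λ { refl → Hole.vx C 0F ≡ p × Hole.vx C 1F ≡ q }
    four-cycle p q r s pq qr rs sp p≢r q≢s = record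
      { len = 4 ; len≥4 = ≤-refl ; vx = vx
      ; induced = injective-from-pairs vx
            ( (Adj⇒≢ pq ∷ p≢r ∷ ≢-sym (Adj⇒≢ sp) ∷ [])
            ∷ (Adj⇒≢ qr ∷ q≢s ∷ [])
            ∷ (Adj⇒≢ rs ∷ [])
            ∷ [] ∷ [])
        , λ a b → (λ e → to a b (trans (sym (pattern-eq a b)) e)) , λ e → trans (pattern-eq a b) (from a b e)
      } , refl , refl , refl
      where
      vx : Fin 4 → V G
      vx = lookup (p ∷ q ∷ r ∷ s ∷ [])

      CycAdj? : ∀ a b → Dec (CycAdj 4 a b)
      CycAdj? a b = (_ ℕ.≟ _) ⊎-dec (_ ℕ.≟ _)

      E : Fin 4 → Fin 4 → Bool
      E a b = does (CycAdj? a b)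

      pattern-eq : ∀ a b → adj (vx a) (vx b) ≡ E a b
      pattern-eq = adjacency-pattern E
        (from-yes (all? λ a → all? λ b → E a b Bool.≟ E b a))
        (from-yes (all? λ a → E a a Bool.≟ false)) vx
        ( (pq ∷ no-triangle pq qr ∷ Adj-sym sp ∷ [])
        ∷ (qr ∷ no-triangle qr rs ∷ [])
        ∷ (rs ∷ [])
        ∷ [] ∷ [])

      to : ∀ a b → E a b ≡ true → CycAdj 4 a b
      to = from-yes (all? λ a → all? λ b → (E a b Bool.≟ true) →-dec CycAdj? a b)

      from : ∀ a b → CycAdj 4 a b → E a b ≡ true
      from = from-yes (all? λ a → all? λ b → CycAdj? a b →-dec (E a b Bool.≟ true))

    -- The eight remaining non-adjacencies of a sunspot follow from triangle-freeness.
    sunspot : ∀ x₁ x₂ x₃ x₄ y₁ y₂ y₃ →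
      Adj G x₁ x₂ → Adj G x₂ x₃ → Adj G x₃ x₄ → Adj G x₄ x₁ →
      Adj G x₁ y₁ → Adj G x₂ y₂ → Adj G x₃ y₃ →
      ¬ Adj G x₁ y₃ → ¬ Adj G x₃ y₁ → ¬ Adj G x₄ y₂ →
      ¬ Adj G y₁ y₂ → ¬ Adj G y₁ y₃ → ¬ Adj G y₂ y₃ →
      ∃ (Is4Sunspot G)
    sunspot x₁ x₂ x₃ x₄ y₁ y₂ y₃ e₁₂ e₂₃ e₃₄ e₄₁ f₁ f₂ f₃ ¬x₁y₃ ¬x₃y₁ ¬x₄y₂ ¬y₁y₂ ¬y₁y₃ ¬y₂y₃ =
      s , (λ {a} {b} eq → separated a b λ c →
            trans (sym (pattern-eq a c)) (trans (cong (λ v → adj v (s c)) eq) (pattern-eq b c)))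
        , λ a b → trans (sym (pattern-eq a b)) , trans (pattern-eq a b)
      where
      s : Fin 7 → V G
      s = lookup (x₁ ∷ x₂ ∷ x₃ ∷ x₄ ∷ y₁ ∷ y₂ ∷ y₃ ∷ [])

      E : Fin 7 → Fin 7 → Bool
      E a b = sunEdgeℕ G (toℕ a) (toℕ b) ∨ sunEdgeℕ G (toℕ b) (toℕ a)

      pattern-eq : ∀ a b → adj (s a) (s b) ≡ E a b
      pattern-eq = adjacency-pattern E (λ a b → ∨-comm (sunEdgeℕ G (toℕ a) (toℕ b)) _)
        (from-yes (all? λ a → E a a Bool.≟ false)) s
        ( (e₁₂ ∷ no-triangle e₁₂ e₂₃ ∷ Adj-sym e₄₁ ∷ f₁ ∷ no-triangle e₁₂ f₂ ∷ ¬-not ¬x₁y₃ ∷ [])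
        ∷ (e₂₃ ∷ no-triangle e₂₃ e₃₄ ∷ no-triangle (Adj-sym e₁₂) f₁ ∷ f₂ ∷ no-triangle e₂₃ f₃ ∷ [])
        ∷ (e₃₄ ∷ ¬-not ¬x₃y₁ ∷ no-triangle (Adj-sym e₂₃) f₂ ∷ f₃ ∷ [])
        ∷ (no-triangle e₄₁ f₁ ∷ ¬-not ¬x₄y₂ ∷ no-triangle (Adj-sym e₃₄) f₃ ∷ [])
        ∷ (¬-not ¬y₁y₂ ∷ ¬-not ¬y₁y₃ ∷ [])
        ∷ (¬-not ¬y₂y₃ ∷ [])
        ∷ [] ∷ [])

      -- Distinct vertices of a sunspot have distinct neighbourhoods, so injectivity is automatic.
      separated : ∀ a b → (∀ c → E a c ≡ E b c) → a ≡ b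
      separated = from-yes (all? λ a → all? λ b → all? (λ c → E a c Bool.≟ E b c) →-dec (a ≟ b))

-- No vertex of the hole lies on a 4-cycle.

module _ (G : Graph) (triangle-free : TriangleFree G) (sunspot-free : SunspotFree4 G)
         (liberal : Liberal G) (flapless : Flapless G) (H : Hole G) (6≤len : 6 ≤ Hole.len H) where
  open Hole H

  vx-injective : Injective _≡_ _≡_ vx
  vx-injective = proj₁ induced

  vx-Adj : ∀ {i j} → CycAdj len i j → Adj G (vx i) (vx j)
  vx-Adj {i} {j} = proj₂ (proj₂ induced i j)

  Adj-vx : ∀ {i j} → Adj G (vx i) (vx j) → CycAdj len i j
  Adj-vx {i} {j} = proj₁ (proj₂ induced i j)

  -- By triangle-freeness the 4-cycle on `vx i`, `vx j`, `r`, `s` is induced, and it contains a hole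
  -- edge.
  no-flap : ∀ {i j r s} → CycAdj len i j → Adj G (vx j) r → Adj G r s → Adj G s (vx i) →
    vx i ≢ r → vx j ≢ s → ⊥
  no-flap {i} {j} ij jr rs si i≢r j≢s
    with four-cycle G triangle-free (vx i) (vx j) _ _ (vx-Adj ij) jr rs si i≢r j≢s
  ... | C , refl , c₀ , c₁ = flapless H 6≤len
    (C , refl , i , j , 0F , 1F , ij , inj₁ refl , sym c₀ , sym c₁)

  1≤len : 1 ≤ len
  1≤len = ≤-trans (s≤s z≤n) 6≤len

  2<len : 2 < len
  2<len = ≤-trans (s≤s (s≤s (s≤s z≤n))) 6≤len

  -- If successor and predecessor agreed, two steps forward would fix `i`, although the hole has
  -- more than two vertices.
  CycAdj-distinct : ∀ (i : Fin len) → rot 1 i ≢ rot (len ∸ 1) i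
  CycAdj-distinct i eq = rot-≢ (s≤s z≤n) 2<len i (begin
    rot 2 i                 ≡⟨ rot-rot 1 1 i ⟨
    rot 1 (rot 1 i)         ≡⟨ cong (rot 1) eq ⟩
    rot 1 (rot (len ∸ 1) i) ≡⟨ rot-rot (len ∸ 1) 1 i ⟩
    rot (len ∸ 1 + 1) i     ≡⟨ cong (λ t → rot t i) (m∸n+n≡m 1≤len) ⟩
    rot len i               ≡⟨ rot-period i ⟩
    i                       ∎)
    where open ≡-Reasoning

  module _ {i a b u} (ia : Adj G (vx i) a) (ib : Adj G (vx i) b) (ua : Adj G u a) (ub : Adj G u b)
           (a≢b : a ≢ b) (u≢i : u ≢ vx i) where
    private
      h = vx i

      ¬hu : ¬ Adj G h u
      ¬hu hu = triangle-free _ _ _ hu ua ia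

      ai = Adj-sym G ia
      bi = Adj-sym G ib
      au = Adj-sym G ua
      bu = Adj-sym G ub

    -- With a private neighbour z of a, z′ of b, w of u, and a hole neighbour y of h, the three
    -- 4-sunspots on the cycle h a u b with middle vertex x₂ = h, a, b force the triangle w z z′
    -- unless w ~ y.
    opposite-neighbour : ∀ {j w} → CycAdj len i j → Adj G u w → ¬ Adj G h w → Adj G w (vx j)
    opposite-neighbour {j} {w} ij uw ¬hw with Adj? G w (vx j)
    ... | yes wy = wy
    ... | no ¬wy = ⊥-elim impossible
      where
      y = vx j
      hy = vx-Adj ij

      -- If `u` were adjacent to `y`, the path `h y u` would close up to a flap through whichever of
      -- `a`, `b` differs from `y`.
      ¬uy : ¬ Adj G u y
      ¬uy uy with y ≟ a
      ... | yes refl = no-flap ij (Adj-sym G uy) ub bi (≢-sym u≢i) a≢b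
      ... | no y≢a   = no-flap ij (Adj-sym G uy) ua ai (≢-sym u≢i) y≢a

      -- Stated for either order of the two neighbours of `h`. The vertex `z` from liberality also
      -- misses `y`, since otherwise `h y z a` is a flap.
      private-nbr : ∀ {a b} → Adj G h a → Adj G h b → Adj G u a → a ≢ b →
        ∃ λ z → Adj G a z × ¬ Adj G b z × ¬ Adj G y z
      private-nbr {a} {b} ha hb ua a≢b
        with liberal a b a≢b (triangle-free _ _ _ (Adj-sym G ha) hb)
      ... | (z , az , ¬bz) , _ = z , az , ¬bz , λ yz →
        no-flap ij yz (Adj-sym G az) (Adj-sym G ha)
          (λ { refl → ¬bz (Adj-sym G hb) }) (λ { refl → ¬uy ua })

      impossible : ⊥
      impossible with private-nbr ia ib ua a≢b | private-nbr ib ia ub (≢-sym a≢b)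
      ... | z , az , ¬bz , ¬yz | z′ , bz′ , ¬az′ , ¬yz′ with Adj? G z z′ | Adj? G z w | Adj? G z′ w
      ... | no ¬zz′ | _ | _ = sunspot-free _ (proj₂ (sunspot G triangle-free a h b u z y z′
              ai ib bu ua az hy bz′ ¬az′ ¬bz ¬uy (¬yz ∘ Adj-sym G) ¬zz′ ¬yz′))
      ... | yes _ | no ¬zw | _ = sunspot-free _ (proj₂ (sunspot G triangle-free h a u b y z w
              ia au ub bi hy az uw ¬hw ¬uy ¬bz ¬yz (¬wy ∘ Adj-sym G) ¬zw))
      ... | yes _ | yes _ | no ¬z′w = sunspot-free _ (proj₂ (sunspot G triangle-free h b u a y z′ w
              ib bu ua ai hy bz′ uw ¬hw ¬uy ¬az′ ¬yz′ (¬wy ∘ Adj-sym G) ¬z′w))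
      ... | yes zz′ | yes zw | yes z′w = triangle-free _ _ _ zz′ z′w zw

    -- A neighbour `w` of `u` outside the neighbourhood of `h` is adjacent to both hole neighbours
    -- of `h`, and these four vertices form a flap.
    no-four-cycle : ⊥
    no-four-cycle with liberal u h u≢i (¬hu ∘ Adj-sym G)
    ... | (w , uw , ¬hw) , _ = no-flap (CycAdj-rot i)
      (Adj-sym G (opposite-neighbour (CycAdj-rot i) uw ¬hw))
      (opposite-neighbour before uw ¬hw)
      (Adj-sym G (vx-Adj before))
      (λ { refl → ¬hu (Adj-sym G uw) })
      (CycAdj-distinct i ∘ vx-injective)
      where before = CycAdj-rot⁻ i 1≤len

  -- Greedy choice of the petals.

  Kills : Fin len → V G → V G → Set
  Kills i k v = k ≢ vx i × Adj G k v

  Kills? : ∀ i k v → Dec (Kills i k v)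
  Kills? i k v = ¬? (k ≟ vx i) ×-dec Adj? G k v

  -- Two neighbours of `vx i` killed by the same `k` would put `vx i` on a 4-cycle. The clause
  -- `k ≢ vx i` in `Kills` rules out `vx i` itself, which is adjacent to all candidates.
  kills-at-most-one : ∀ {i k v w} → Adj G (vx i) v → Adj G (vx i) w → Kills i k v → Kills i k w → v ≡ w
  kills-at-most-one {v = v} {w} iv iw (k≢i , kv) (_ , kw) with v ≟ w
  ... | yes v≡w = v≡w
  ... | no v≢w  = ⊥-elim (no-four-cycle iv iw kv kw v≢w k≢i)

  module _ (d : ℕ) (min-degree : MinDegreeAtLeast G (4 * suc d ∸ 1)) where

    Petal : Fin len → V G → Set
    Petal i v = Adj G (vx i) v × ¬ InHole G H v ×
      (∀ j → i ≢ j → cycDist len i j ≤ suc d → ¬ Adj G v (vx j))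

    Compatible : Fin len → Fin len → V G → V G → Set
    Compatible i j v w = cycDist len i j ≤ suc d → ¬ Adj G v w

    -- The two hole vertices at distance two are listed separately: they kill the hole
    -- neighbours of vx i even when d = 0.
    killers : Fin len → (Fin len → V G) → List (V G)
    killers i φ = vx (rot 2 i) ∷ vx (rot (len ∸ 2) i) ∷ map vx (nearby d i) ++ map φ (nearby d i)

    -- There are `2 + 4 * d` killers, and the safety radius is `suc d`, so the degree bound
    -- `4 * suc d ∸ 1 = 3 + 4 * d` exceeds their number by exactly one.
    killers-short : ∀ i φ → length (killers i φ) < length (neighbours G (vx i))
    killers-short i φ = ≤-trans (≤-reflexive count) (min-degree (vx i))
      where
      arith : ∀ d → 3 + ((d + d) + (d + d)) ≡ 3 + 4 * d
      arith = solve-∀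
      count : suc (length (killers i φ)) ≡ 4 * suc d ∸ 1
      count rewrite length-++ (map vx (nearby d i)) {map φ (nearby d i)}
                  | length-map vx (nearby d i) | length-map φ (nearby d i) | length-nearby d i
                  = trans (arith d) (cong (_∸ 1) (sym (*-suc 4 d)))

    extend : ∀ i (φ : Fin len → V G) →
      ∃ λ v → Petal i v × (∀ j → i ≢ j → Petal j (φ j) → Compatible i j v (φ j))
    extend i φ with unrelated-element (Kills? i) (killers i φ) (neighbours G (vx i))
      (neighbours-unique G (vx i))
      (λ v∈ w∈ → kills-at-most-one (∈-neighbours⁻ G v∈) (∈-neighbours⁻ G w∈))
      (killers-short i φ)
    ... | v , v∈ , survives = v , (iv , outside , far) , compatible
      where
      iv = ∈-neighbours⁻ G v∈

      vx-≢ : ∀ {j} → i ≢ j → vx j ≢ vx i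
      vx-≢ i≢j eq = i≢j (sym (vx-injective eq))

      outside : ¬ InHole G H v
      -- A hole vertex adjacent to `vx i` is its successor or predecessor, and each of these is
      -- killed by the hole vertex one step further on.
      outside (j , refl) with CycAdj⇒rot (Adj-vx iv)
      ... | inj₁ refl = survives (here refl)
        ( vx-≢ (≢-sym (rot-≢ (s≤s z≤n) 2<len i))
        , Adj-sym G (vx-Adj (subst (CycAdj len (rot 1 i)) (rot-rot 1 1 i) (CycAdj-rot (rot 1 i)))))
      -- Here `i` is `rot 1 j`, so the killer two steps before `i` is one step before `j`.
      ... | inj₂ refl = survives (there (here refl))
        ( vx-≢ (≢-sym (rot-≢ (m<n⇒0<n∸m 2<len) (∸-monoʳ-< (s≤s z≤n) (<⇒≤ 2<len)) i))
        , vx-Adj (subst (CycAdj len _) back (CycAdj-rot (rot (len ∸ 2) i))))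
        where
        open ≡-Reasoning
        back : rot 1 (rot (len ∸ 2) i) ≡ j
        back = begin
          rot 1 (rot (len ∸ 2) (rot 1 j)) ≡⟨ cong (rot 1) (rot-rot 1 (len ∸ 2) j) ⟩
          rot 1 (rot (suc (len ∸ 2)) j)   ≡⟨ rot-rot (suc (len ∸ 2)) 1 j ⟩
          rot (suc (len ∸ 2) + 1) j       ≡⟨ cong (λ t → rot t j) (sym (+-suc (len ∸ 2) 1)) ⟩
          rot (len ∸ 2 + 2) j             ≡⟨ cong (λ t → rot t j) (m∸n+n≡m (<⇒≤ 2<len)) ⟩
          rot len j                       ≡⟨ rot-period j ⟩
          j                               ∎

      far : ∀ j → i ≢ j → cycDist len i j ≤ suc d → ¬ Adj G v (vx j)
      far j i≢j near vj with ∈-nearby i j 1≤len i≢j near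
      ... | inj₁ ij = triangle-free _ _ _ iv vj (vx-Adj ij)
      ... | inj₂ j∈ = survives (there (there (∈-++⁺ˡ (∈-map⁺ vx j∈)))) (vx-≢ i≢j , Adj-sym G vj)

      compatible : ∀ j → i ≢ j → Petal j (φ j) → Compatible i j v (φ j)
      compatible j i≢j (jφ , φ-outside , _) near vφ with ∈-nearby i j 1≤len i≢j near
      -- For hole neighbours, adjacent petals would give the 4-cycle `vx i`, `vx j`, `φ j`, `v`.
      ... | inj₁ ij = no-four-cycle (vx-Adj ij) iv (Adj-sym G jφ) (Adj-sym G vφ)
        (λ eq → outside (j , eq)) (λ eq → φ-outside (i , sym eq))
      ... | inj₂ j∈ = survives (there (there (∈-++⁺ʳ (map vx (nearby d i)) (∈-map⁺ φ j∈))))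
        ((λ eq → φ-outside (i , sym eq)) , Adj-sym G vφ)

    safe-flare : Σ (Flare G H) λ F → Full G F × Safe G F (suc d)
    safe-flare with greedy-choice Petal Compatible vx extend
    ... | φ , petal , compatible = flare , (λ i → φ i , refl) , safe
      where
      flare : Flare G H
      flare = record
        { Φ       = just ∘ φ
        ; inNbr   = λ { i _ refl → proj₁ (petal i) }
        ; outside = λ { i _ refl → proj₁ (proj₂ (petal i)) }
        }

      nonadjacent : ∀ i j → i ≢ j → cycDist len i j ≤ suc d → ¬ Adj G (φ i) (φ j)
      nonadjacent i j i≢j near with <-cmp i j
      ... | tri< i<j _ _ = compatible i j i<j near
      ... | tri≈ _ i≡j _ = contradiction i≡j i≢j
      ... | tri> _ _ j<i =
        compatible j i j<i (subst (_≤ suc d) (cycDist-comm len i j) near) ∘ Adj-sym G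

      safe : Safe G flare (suc d)
      -- The petals differ because `φ j` is adjacent to `vx j` while `φ i` is not.
      safe i j i≢j near _ _ refl (inj₁ refl) =
        ≢-sym (distinguished G (Adj-sym G (proj₁ (petal j))) (proj₂ (proj₂ (petal i)) j i≢j near))
        , nonadjacent i j i≢j near
      safe i j i≢j near _ _ refl (inj₂ refl) =
        (λ eq → proj₁ (proj₂ (petal i)) (j , sym eq)) , proj₂ (proj₂ (petal i)) j i≢j near

theorem3p1 : (d : ℕ) → 1 ≤ d → (G : Graph) →
    TriangleFree G → SunspotFree4 G → MinDegreeAtLeast G (4 * d ∸ 1) →
    Liberal G → Flapless G →
    (H : Hole G) → 6 ≤ Hole.len H →
    Σ (Flare G H) λ F → Full G F × Safe G F d
theorem3p1 (suc d) _ G triangle-free sunspot-free min-degree liberal flapless H 6≤len =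
  safe-flare G triangle-free sunspot-free liberal flapless H 6≤len d min-degree
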